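{- For all nonnegative integers $n,m,k$, $$\det\left(\binom{i+j+k+m}{i-j+m}\right)_{i,j=0}^{n-1}=\det\left(\binom{2n+m+k-i-j}{j-i+m}\right)_{i,j=1}^{n}=\det\left(C_{n-i+j}^{(2i+k+1)}\right)_{i,j=0}^{m-1}.$$
   Context: Binomial coefficients $\binom{a}{b}$ with $a\ge0$ vanish if $b<0$ or $b>a$. For a positive integer $r$ and integer $\ell$, $C_\ell^{(r)}=\frac{r}{2\ell+r}\binom{2\ell+r}{\ell}$ if $\ell\ge0$ and $C_\ell^{(r)}=0$ if $\ell<0$; equivalently $\sum_{\ell\ge0}C_\ell^{(r)}z^\ell=c(z)^r$ where $c(z)=\sum_{\ell\ge0}\frac{1}{\ell+1}\binom{2\ell}{\ell}z^\ell$ is the Catalan generating function. Determinants of $0\times0$ matrices equal $1$. -}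

module Defs where

open import Data.Nat as ℕ using (ℕ; zero; suc)
open import Data.Nat.Combinatorics using (_C_)
open import Data.Nat.DivMod using (_/_)
open import Data.Integer as ℤ using (ℤ; +_; -[1+_])
open import Data.Fin using (Fin; toℕ; punchIn)
import Data.Fin as Fin

-- Binomial coefficient binom a b for integers a, b, following the convention:
-- for a ≥ 0 it vanishes when b < 0 or b > a (stdlib's  n C k  is 0 for k > n).
-- In the theorem the top argument is always ≥ 0; we set it to 0 when a < 0
-- (that case never occurs).
binomℤ : ℤ → ℤ → ℤ
binomℤ (+ a) (+ b) = + (a C b)
binomℤ _ _ = + 0

-- C^{(r)}_ℓ = r/(2ℓ+r) * binom(2ℓ+r, ℓ) for ℓ ≥ 0, and 0 for ℓ < 0.
-- Here r is a positive integer given as suc r' (so r = suc r'); the division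
-- is exact (the value is an integer); 2ℓ+r is written suc (2ℓ+r') ≥ 1.
ballot : (r' : ℕ) → ℤ → ℤ
ballot r' (+ l) = + ((suc r' ℕ.* (suc (2 ℕ.* l ℕ.+ r') C l)) / suc (2 ℕ.* l ℕ.+ r'))
ballot r' -[1+ _ ] = + 0

Matrix : ℕ → Set
Matrix n = Fin n → Fin n → ℤ

minor : ∀ {n} → Fin (suc n) → Matrix (suc n) → Matrix n
minor j M r c = M (Fin.suc r) (punchIn j c)

altSum : ∀ {n} → (Fin n → ℤ) → ℤ
altSum {zero} f = + 0
altSum {suc n} f = f Fin.zero ℤ.- altSum (λ j → f (Fin.suc j))

det : ∀ {n} → Matrix n → ℤ
det {zero} M = + 1
det {suc n} M = altSum (λ j → M Fin.zero j ℤ.* det (minor j M))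

{-# OPTIONS --safe #-}

-- Reversing the order of rows and columns turns the second matrix into the
-- first.  The first one is the submatrix of the lower unitriangular Riordan array
-- L(r, s) = binom(r + s + k, r - s) with rows m, …, m + n - 1 and columns
-- 0, …, n - 1.  Since c(-z / (1 - z)^2) = 1 - z, the inverse of L is
-- M(r, s) = (-1)^(r - s) C_{r-s}^{(2s+k+1)}, and Jacobi's identity for
-- complementary minors gives the m × m determinant; its sign (-1)^(mn) cancels
-- the signs in M.
module Submission where

open import Defs
open import Data.Nat using (ℕ; zero; suc; s≤s; z<s; s<s; _∸_; _<_)
import Data.Nat as ℕ
import Data.Nat.Properties as ℕ
open import Data.Nat.Combinatorics using (_C_; nC1≡n; nCn≡1; nCk+nC[k+1]≡[n+1]C[k+1]; k>n⇒nCk≡0)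
open import Data.Nat.DivMod using (_/_; m*n/n≡m)
import Data.Nat.Tactic.RingSolver as ℕRing
open import Data.Integer using (ℤ; +_; -[1+_]; _+_; _-_; _*_; -_; _^_; +[1+_]; 0ℤ; 1ℤ; -1ℤ)
import Data.Integer.Properties as ℤ
open import Data.Integer.Tactic.RingSolver using (solve-∀)
open import Data.Fin using (Fin; toℕ; punchIn)
import Data.Fin as Fin
import Data.Fin.Properties as Fin
open import Data.Product using (_×_; _,_)
open import Relation.Binary.PropositionalEquality
open ≡-Reasoning

-- The identity c(-z / (1 - z)^2) = 1 - z is obtained without composing power series. The equation c
-- = 1 + z c^2 is quadratic in c, but multiplied by c^b it is linear in the family of powers of c.
-- Read coefficientwise, it gives `S` a recurrence that the coefficients of (1 - z)^(-d) obey as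
-- well, so two inductive families are compared and no algebra of series is built. On the
-- determinant side `L` is unitriangular, so multiplication by it only adds multiples of rows to
-- later rows. Row addition, swaps and transposition, all derived from expansion along the first
-- row, therefore take the place of the general product formula.

-- Alternating sums

Seq Mat : Set
Seq = ℕ → ℤ
Mat = ℕ → Seq

-- The increasing map that misses `j`: `punchIn` with the bounds dropped.
skip : ℕ → ℕ → ℕ
skip zero    c       = suc c
skip (suc j) zero    = zero
skip (suc j) (suc c) = suc (skip j c)

asum : ℕ → Seq → ℤ
asum zero    g = 0ℤ
asum (suc n) g = g 0 - asum n (λ j → g (suc j))

-- Determinant of the leading n × n block of an infinite matrix.  Indexing by ℕ keeps
-- matrix sizes such as m + n and n + m out of the types.
D : ℕ → Mat → ℤ
D zero    f = 1ℤ
D (suc n) f = asum (suc n) (λ j → f 0 j * D n (λ r c → f (suc r) (skip j c)))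

asum-cong : ∀ n {g h : Seq} → (∀ j → g j ≡ h j) → asum n g ≡ asum n h
asum-cong zero    e = refl
asum-cong (suc n) e = cong₂ _-_ (e 0) (asum-cong n (λ j → e (suc j)))

asum-linear : ∀ n a (g h : Seq) → asum n (λ j → g j + a * h j) ≡ asum n g + a * asum n h
asum-linear zero    a g h = sym (trans (ℤ.+-identityˡ _) (ℤ.*-zeroʳ a))
asum-linear (suc n) a g h = begin
  g 0 + a * h 0 - asum n (λ j → g (suc j) + a * h (suc j))
    ≡⟨ cong (_-_ (g 0 + a * h 0)) (asum-linear n a _ _) ⟩
  g 0 + a * h 0 - (asum n (λ j → g (suc j)) + a * asum n (λ j → h (suc j)))
    ≡⟨ regroup a (g 0) (h 0) _ _ ⟩
  asum (suc n) g + a * asum (suc n) h ∎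
  where
  regroup : ∀ a x y s t → x + a * y - (s + a * t) ≡ (x - s) + a * (y - t)
  regroup = solve-∀

asum-zero : ∀ n {g : Seq} → (∀ j → g j ≡ 0ℤ) → asum n g ≡ 0ℤ
asum-zero zero    e = refl
asum-zero (suc n) e rewrite e 0 | asum-zero n (λ j → e (suc j)) = refl

asum-*ˡ : ∀ n a (g : Seq) → asum n (λ j → a * g j) ≡ a * asum n g
asum-*ˡ zero    a g = sym (ℤ.*-zeroʳ a)
asum-*ˡ (suc n) a g =
  trans (cong (_-_ (a * g 0)) (asum-*ˡ n a _)) (factor a (g 0) _)
  where
  factor : ∀ a x y → a * x - a * y ≡ a * (x - y)
  factor = solve-∀

asum-comm : ∀ p q (F : ℕ → ℕ → ℤ) →
  asum p (λ j → asum q (λ i → F i j)) ≡ asum q (λ i → asum p (λ j → F i j))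
asum-comm zero    q F = sym (asum-zero q (λ _ → refl))
asum-comm (suc p) q F = begin
  asum q (λ i → F i 0) - asum p (λ j → asum q (λ i → F i (suc j)))
    ≡⟨ cong (_-_ (asum q (λ i → F i 0))) (asum-comm p q _) ⟩
  asum q (λ i → F i 0) - asum q (λ i → asum p (λ j → F i (suc j)))
    ≡⟨ minus (asum q (λ i → F i 0)) (asum q (λ i → asum p (λ j → F i (suc j)))) ⟩
  asum q (λ i → F i 0) + -1ℤ * asum q (λ i → asum p (λ j → F i (suc j)))
    ≡⟨ asum-linear q -1ℤ (λ i → F i 0) (λ i → asum p (λ j → F i (suc j))) ⟨
  asum q (λ i → F i 0 + -1ℤ * asum p (λ j → F i (suc j)))
    ≡⟨ asum-cong q (λ i → sym (minus (F i 0) (asum p (λ j → F i (suc j))))) ⟩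
  asum q (λ i → asum (suc p) (λ j → F i j)) ∎
  where
  minus : ∀ x y → x - y ≡ x + -1ℤ * y
  minus x y = cong (_+_ x) (sym (ℤ.-1*i≡-i y))

asum-exchange : ∀ p q (a b : Seq) (Z : ℕ → ℕ → ℤ) →
  asum p (λ j → a j * asum q (λ i → b i * Z i j)) ≡
  asum q (λ i → b i * asum p (λ j → a j * Z i j))
asum-exchange p q a b Z = begin
  asum p (λ j → a j * asum q (λ i → b i * Z i j))
    ≡⟨ asum-cong p (λ j → asum-*ˡ q (a j) _) ⟨
  asum p (λ j → asum q (λ i → a j * (b i * Z i j)))
    ≡⟨ asum-comm p q _ ⟩
  asum q (λ i → asum p (λ j → a j * (b i * Z i j)))
    ≡⟨ asum-cong q (λ i → asum-cong p (λ j → swap (a j) (b i) (Z i j))) ⟩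
  asum q (λ i → asum p (λ j → b i * (a j * Z i j)))
    ≡⟨ asum-cong q (λ i → asum-*ˡ p (b i) _) ⟩
  asum q (λ i → b i * asum p (λ j → a j * Z i j)) ∎
  where
  swap : ∀ x y z → x * (y * z) ≡ y * (x * z)
  swap = solve-∀

-- Transposition and elementary row operations

-- Only rows carry a bound: columns pass through `skip`, rows merely shift by one. The bound matters
-- where `n ∸ i` truncates and where `append m` runs past its first block.
D-cong< : ∀ n (f g : Mat) → (∀ {i} → i < n → ∀ j → f i j ≡ g i j) → D n f ≡ D n g
D-cong< zero    f g e = refl
D-cong< (suc n) f g e = asum-cong (suc n) λ j →
  cong₂ _*_ (e z<s j) (D-cong< n _ _ λ i<n c → e (s<s i<n) (skip j c))

D-cong : ∀ n (f g : Mat) → (∀ i j → f i j ≡ g i j) → D n f ≡ D n g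
D-cong n f g e = D-cong< n f g (λ {i} _ → e i)

-- Induction step for row operations that fix the top row: they act inside the minors, all with the
-- same factor.
D-by-minors : ∀ n (f g : Mat) s → (∀ c → f 0 c ≡ g 0 c) →
  (∀ j → D n (λ r c → f (suc r) (skip j c)) ≡ s * D n (λ r c → g (suc r) (skip j c))) →
  D (suc n) f ≡ s * D (suc n) g
D-by-minors n f g s e₀ e = trans
  (asum-cong (suc n) λ j → trans (cong₂ _*_ (e₀ j) (e j)) (swap (g 0 j) s (cofactor j)))
  (asum-*ˡ (suc n) s (λ j → g 0 j * cofactor j))
  where
  cofactor : Seq
  cofactor j = D n (λ r c → g (suc r) (skip j c))
  swap : ∀ x y z → x * (y * z) ≡ y * (x * z)
  swap = solve-∀

-- Expanding along the first row and then along the first column of the minors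
-- gives a double sum which is symmetric in rows and columns.
column-expansion : ∀ n (f : Mat) →
  D (suc n) f ≡ asum (suc n) (λ i → f i 0 * D n (λ r c → f (skip i r) (suc c)))
column-expansion zero    f = refl
-- The `f 0 0` term is common to both expansions. The other minors retain column 0, since
-- `skip (suc j) 0` is `0`, and the induction hypothesis expands them along it.
column-expansion (suc n) f = cong (_-_ (f 0 0 * D (suc n) (λ r c → f (suc r) (suc c)))) (trans
  (asum-cong (suc n) λ j → cong (f 0 (suc j) *_) (column-expansion n (λ r c → f (suc r) (skip (suc j) c))))
  (asum-exchange (suc n) (suc n) (λ j → f 0 (suc j)) (λ i → f (suc i) 0)
    (λ i j → D n (λ r c → f (suc (skip i r)) (suc (skip j c))))))

D-transpose : ∀ n (f : Mat) → D n (λ i j → f j i) ≡ D n f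
D-transpose zero    f = refl
D-transpose (suc n) f = trans
  (asum-cong (suc n) λ j → cong (f j 0 *_) (D-transpose n (λ r c → f (skip j r) (suc c))))
  (sym (column-expansion n f))

swap₀₁ : ℕ → ℕ
swap₀₁ 0             = 1
swap₀₁ 1             = 0
swap₀₁ (suc (suc i)) = suc (suc i)

-- In the expansion along the first column the two leading terms trade places and hence signs. Every
-- later minor still has both swapped rows on top, because `skip (2 + i)` fixes 0 and 1, so
-- induction negates it.
D-swap : ∀ n (f : Mat) → D (2 ℕ.+ n) (λ i → f (swap₀₁ i)) ≡ - D (2 ℕ.+ n) f
D-swap n f = begin
  D (2 ℕ.+ n) (λ i → f (swap₀₁ i))
    ≡⟨ column-expansion (suc n) (λ i → f (swap₀₁ i)) ⟩
  f 1 0 * D (suc n) (λ r c → f (swap₀₁ (suc r)) (suc c))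
    - (f 0 0 * D (suc n) (λ r c → f (swap₀₁ (skip 1 r)) (suc c)) - lower n (λ i → f (swap₀₁ i)))
    ≡⟨ cong₂ (λ x y → f 1 0 * x - y)
         minor₀ (cong₂ (λ x y → f 0 0 * x - y) minor₁ (lower-swap n)) ⟩
  f 1 0 * D (suc n) (λ r c → f (skip 1 r) (suc c))
    - (f 0 0 * D (suc n) (λ r c → f (suc r) (suc c)) - - lower n f)
    ≡⟨ negate (f 1 0 * D (suc n) (λ r c → f (skip 1 r) (suc c)))
         (f 0 0 * D (suc n) (λ r c → f (suc r) (suc c))) (lower n f) ⟩
  - (f 0 0 * D (suc n) (λ r c → f (suc r) (suc c))
    - (f 1 0 * D (suc n) (λ r c → f (skip 1 r) (suc c)) - lower n f))
    ≡⟨ cong -_ (column-expansion (suc n) f) ⟨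
  - D (2 ℕ.+ n) f ∎
  where
  negate : ∀ x y s → x - (y - - s) ≡ - (y - (x - s))
  negate = solve-∀
  swap-neg : ∀ x y → x * - y ≡ -1ℤ * (x * y)
  swap-neg = solve-∀
  cofactor : ℕ → Mat → Seq
  cofactor k g i = D (suc k) (λ r c → g (skip (2 ℕ.+ i) r) (suc c))
  lower : ℕ → Mat → ℤ
  lower k g = asum k (λ i → g (2 ℕ.+ i) 0 * cofactor k g i)
  cofactor-swap : ∀ k i → cofactor (suc k) (λ i → f (swap₀₁ i)) i ≡ - cofactor (suc k) f i
  cofactor-swap k i = trans
    (D-cong (2 ℕ.+ k) (λ r c → f (swap₀₁ (skip (2 ℕ.+ i) r)) (suc c))
      (λ r c → f (skip (2 ℕ.+ i) (swap₀₁ r)) (suc c))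
      λ { 0 c → refl ; 1 c → refl ; (suc (suc r)) c → refl })
    (D-swap k (λ r c → f (skip (2 ℕ.+ i) r) (suc c)))
  lower-swap : ∀ k → lower k (λ i → f (swap₀₁ i)) ≡ - lower k f
  lower-swap zero    = refl
  lower-swap (suc k) = begin
    lower (suc k) (λ i → f (swap₀₁ i))
      ≡⟨ asum-cong (suc k) (λ i → trans (cong (f (2 ℕ.+ i) 0 *_) (cofactor-swap k i))
           (swap-neg (f (2 ℕ.+ i) 0) (cofactor (suc k) f i))) ⟩
    asum (suc k) (λ i → -1ℤ * (f (2 ℕ.+ i) 0 * cofactor (suc k) f i))
      ≡⟨ asum-*ˡ (suc k) -1ℤ (λ i → f (2 ℕ.+ i) 0 * cofactor (suc k) f i) ⟩
    -1ℤ * lower (suc k) f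
      ≡⟨ ℤ.-1*i≡-i (lower (suc k) f) ⟩
    - lower (suc k) f ∎
  minor₀ : D (suc n) (λ r c → f (swap₀₁ (suc r)) (suc c)) ≡ D (suc n) (λ r c → f (skip 1 r) (suc c))
  minor₀ = D-cong (suc n) (λ r c → f (swap₀₁ (suc r)) (suc c)) (λ r c → f (skip 1 r) (suc c))
    λ { zero c → refl ; (suc r) c → refl }
  minor₁ : D (suc n) (λ r c → f (swap₀₁ (skip 1 r)) (suc c)) ≡ D (suc n) (λ r c → f (suc r) (suc c))
  minor₁ = D-cong (suc n) (λ r c → f (swap₀₁ (skip 1 r)) (suc c)) (λ r c → f (suc r) (suc c))
    λ { zero c → refl ; (suc r) c → refl }

infixr 5 _◂_
_◂_ : ∀ {A : Set} → A → (ℕ → A) → ℕ → A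
(x ◂ Y) zero    = x
(x ◂ Y) (suc i) = Y i

-- The swap fixes this matrix yet negates its determinant, and an integer equal to its own negative
-- is 0.
D-equal-rows : ∀ n (x : Seq) (Z : Mat) → D (2 ℕ.+ n) (x ◂ x ◂ Z) ≡ 0ℤ
D-equal-rows n x Z = self-neg (trans
  (D-cong (2 ℕ.+ n) (x ◂ x ◂ Z) (λ i → (x ◂ x ◂ Z) (swap₀₁ i))
    λ { 0 c → refl ; 1 c → refl ; (suc (suc i)) c → refl })
  (D-swap n (x ◂ x ◂ Z)))
  where
  self-neg : ∀ {i} → i ≡ - i → i ≡ 0ℤ
  self-neg {+ zero}   e = refl
  self-neg { +[1+ i ]} ()
  self-neg { -[1+ i ]} ()

D-linear : ∀ n a (x y : Seq) (Z : Mat) →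
  D (suc n) ((λ c → x c + a * y c) ◂ Z) ≡ D (suc n) (x ◂ Z) + a * D (suc n) (y ◂ Z)
D-linear n a x y Z = trans
  (asum-cong (suc n) λ j → distrib a (x j) (y j) (cofactor j))
  (asum-linear (suc n) a (λ j → x j * cofactor j) (λ j → y j * cofactor j))
  where
  cofactor : Seq
  cofactor j = D n (λ r c → Z r (skip j c))
  distrib : ∀ a x y m → (x + a * y) * m ≡ x * m + a * (y * m)
  distrib = solve-∀

-- A swap puts the first modified row on top of `x`, and linearity splits it. The summand with `x`
-- twice vanishes. In the other, every minor has `x` above the remaining modified rows, so induction
-- applies; a second swap restores the order.
D-add-row : ∀ n (a : Seq) (x : Seq) (Y : Mat) →
  D (suc n) (x ◂ λ i c → Y i c + a i * x c) ≡ D (suc n) (x ◂ Y)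
D-add-row zero    a x Y = refl
D-add-row (suc n) a x Y = begin
  D (2 ℕ.+ n) (x ◂ Y+)
    ≡⟨ ℤ.neg-involutive (D (2 ℕ.+ n) (x ◂ Y+)) ⟨
  - - D (2 ℕ.+ n) (x ◂ Y+)
    ≡⟨ cong -_ (D-swap n (x ◂ Y+)) ⟨
  - D (2 ℕ.+ n) (λ i → (x ◂ Y+) (swap₀₁ i))
    ≡⟨ cong -_ (D-cong (2 ℕ.+ n) (λ i → (x ◂ Y+) (swap₀₁ i)) (Y+ 0 ◂ x ◂ λ i → Y+ (suc i))
         λ { 0 c → refl ; 1 c → refl ; (suc (suc i)) c → refl }) ⟩
  - D (2 ℕ.+ n) (Y+ 0 ◂ x ◂ λ i → Y+ (suc i))
    ≡⟨ cong -_ (D-linear (suc n) (a 0) (Y 0) x (x ◂ λ i → Y+ (suc i))) ⟩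
  - (D (2 ℕ.+ n) (Y 0 ◂ x ◂ λ i → Y+ (suc i)) + a 0 * D (2 ℕ.+ n) (x ◂ x ◂ λ i → Y+ (suc i)))
    ≡⟨ cong₂ (λ p q → - (p + a 0 * q)) below (D-equal-rows n x (λ i → Y+ (suc i))) ⟩
  - (1ℤ * D (2 ℕ.+ n) (λ i → (x ◂ Y) (swap₀₁ i)) + a 0 * 0ℤ)
    ≡⟨ cong (λ p → - (1ℤ * p + a 0 * 0ℤ)) (D-swap n (x ◂ Y)) ⟩
  - (1ℤ * - D (2 ℕ.+ n) (x ◂ Y) + a 0 * 0ℤ)
    ≡⟨ tidy (a 0) (D (2 ℕ.+ n) (x ◂ Y)) ⟩
  D (2 ℕ.+ n) (x ◂ Y) ∎
  where
  Y+ : Mat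
  Y+ i c = Y i c + a i * x c
  tidy : ∀ b d → - (1ℤ * - d + b * 0ℤ) ≡ d
  tidy = solve-∀
  below : D (2 ℕ.+ n) (Y 0 ◂ x ◂ λ i → Y+ (suc i)) ≡ 1ℤ * D (2 ℕ.+ n) (λ i → (x ◂ Y) (swap₀₁ i))
  below = D-by-minors (suc n) (Y 0 ◂ x ◂ λ i → Y+ (suc i)) (λ i → (x ◂ Y) (swap₀₁ i)) 1ℤ (λ _ → refl) λ j → begin
    D (suc n) (λ r c → (x ◂ λ i → Y+ (suc i)) r (skip j c))
      ≡⟨ D-cong (suc n) (λ r c → (x ◂ λ i → Y+ (suc i)) r (skip j c))
           ((λ c → x (skip j c)) ◂ λ i c → Y (suc i) (skip j c) + a (suc i) * x (skip j c))
           (λ { zero c → refl ; (suc r) c → refl }) ⟩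
    D (suc n) ((λ c → x (skip j c)) ◂ λ i c → Y (suc i) (skip j c) + a (suc i) * x (skip j c))
      ≡⟨ D-add-row n (λ i → a (suc i)) (λ c → x (skip j c)) (λ i c → Y (suc i) (skip j c)) ⟩
    D (suc n) ((λ c → x (skip j c)) ◂ λ i c → Y (suc i) (skip j c))
      ≡⟨ D-cong (suc n) ((λ c → x (skip j c)) ◂ λ i c → Y (suc i) (skip j c))
           (λ r c → (x ◂ Y) (swap₀₁ (suc r)) (skip j c))
           (λ { zero c → refl ; (suc r) c → refl }) ⟩
    D (suc n) (λ r c → (x ◂ Y) (swap₀₁ (suc r)) (skip j c))
      ≡⟨ ℤ.*-identityˡ (D (suc n) (λ r c → (x ◂ Y) (swap₀₁ (suc r)) (skip j c))) ⟨
    1ℤ * D (suc n) (λ r c → (x ◂ Y) (swap₀₁ (suc r)) (skip j c)) ∎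

-- Unitriangular factors

sum : ℕ → Seq → ℤ
sum zero    g = 0ℤ
sum (suc n) g = g 0 + sum n (λ s → g (suc s))

sum-cong : ∀ n {g h : Seq} → (∀ s → g s ≡ h s) → sum n g ≡ sum n h
sum-cong zero    e = refl
sum-cong (suc n) e = cong₂ _+_ (e 0) (sum-cong n (λ s → e (suc s)))

-- Product with a lower triangular L: entries of L above the diagonal are never read.
_⊡_ : Mat → Mat → Mat
(L ⊡ X) i c = sum (suc i) (λ s → L i s * X s c)

-- Row `suc i` of the product is row `i` of the product of the shifted matrices plus `L (suc i) 0`
-- times the top row. `D-add-row` clears that multiple, and each minor is again such a product,
-- since choosing columns commutes with `_⊡_`.
D-unitriangular : ∀ n (L X : Mat) → (∀ i → L i i ≡ 1ℤ) → D n (L ⊡ X) ≡ D n X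
D-unitriangular zero    L X unit = refl
D-unitriangular (suc n) L X unit = begin
  D (suc n) (L ⊡ X)
    ≡⟨ D-cong (suc n) (L ⊡ X) (X 0 ◂ λ i c → (L′ ⊡ X′) i c + L (suc i) 0 * X 0 c)
         (λ { zero c → first (L 0 0) (X 0 c) (unit 0) ; (suc i) c → ℤ.+-comm (L (suc i) 0 * X 0 c) _ }) ⟩
  D (suc n) (X 0 ◂ λ i c → (L′ ⊡ X′) i c + L (suc i) 0 * X 0 c)
    ≡⟨ D-add-row n (λ i → L (suc i) 0) (X 0) (L′ ⊡ X′) ⟩
  D (suc n) (X 0 ◂ L′ ⊡ X′)
    ≡⟨ asum-cong (suc n) (λ j → cong (X 0 j *_)
         (D-unitriangular n L′ (λ r c → X′ r (skip j c)) (λ i → unit (suc i)))) ⟩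
  D (suc n) X ∎
  where
  L′ X′ : Mat
  L′ i s = L (suc i) (suc s)
  X′ s   = X (suc s)
  first : ∀ l x → l ≡ 1ℤ → l * x + 0ℤ ≡ x
  first _ x refl = trans (ℤ.+-identityʳ _) (ℤ.*-identityˡ x)

-- Moving and reversing rows

insert : ∀ {A : Set} → ℕ → A → (ℕ → A) → ℕ → A
insert zero    x Y = x ◂ Y
insert (suc p) x Y = Y 0 ◂ insert p x (λ i → Y (suc i))

insert-map : ∀ {A B : Set} (h : A → B) p x (Y : ℕ → A) i →
  h (insert p x Y i) ≡ insert p (h x) (λ j → h (Y j)) i
insert-map h zero    x Y zero    = refl
insert-map h zero    x Y (suc i) = refl
insert-map h (suc p) x Y zero    = refl
insert-map h (suc p) x Y (suc i) = insert-map h p x (λ j → Y (suc j)) i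

-- Each adjacent swap contributes -1. Induction inside the minors lifts `x` to position 1, and one
-- `D-swap` brings it to the top.
D-insert : ∀ n {p} → p ℕ.≤ n → (x : Seq) (Y : Mat) →
  D (suc n) (insert p x Y) ≡ (-1ℤ ^ p) * D (suc n) (x ◂ Y)
D-insert n {zero} p≤n x Y = sym (ℤ.*-identityˡ (D (suc n) (x ◂ Y)))
D-insert (suc n) {suc p} (s≤s p≤n) x Y = begin
  D (2 ℕ.+ n) (Y 0 ◂ insert p x Y′)
    ≡⟨ D-by-minors (suc n) (Y 0 ◂ insert p x Y′) (Y 0 ◂ x ◂ Y′) (-1ℤ ^ p) (λ _ → refl) (λ j → begin
      D (suc n) (λ r c → insert p x Y′ r (skip j c))
        ≡⟨ D-cong (suc n) (λ r c → insert p x Y′ r (skip j c))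
             (insert p (λ c → x (skip j c)) (λ r c → Y′ r (skip j c)))
             (λ r c → cong (λ z → z c) (insert-map (λ z c → z (skip j c)) p x Y′ r)) ⟩
      D (suc n) (insert p (λ c → x (skip j c)) (λ r c → Y′ r (skip j c)))
        ≡⟨ D-insert n p≤n (λ c → x (skip j c)) (λ r c → Y′ r (skip j c)) ⟩
      (-1ℤ ^ p) * D (suc n) ((λ c → x (skip j c)) ◂ λ r c → Y′ r (skip j c))
        ≡⟨ cong ((-1ℤ ^ p) *_) (D-cong (suc n) ((λ c → x (skip j c)) ◂ λ r c → Y′ r (skip j c))
             (λ r c → (x ◂ Y′) r (skip j c)) (λ { zero c → refl ; (suc r) c → refl })) ⟩
      (-1ℤ ^ p) * D (suc n) (λ r c → (x ◂ Y′) r (skip j c)) ∎) ⟩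
  (-1ℤ ^ p) * D (2 ℕ.+ n) (Y 0 ◂ x ◂ Y′)
    ≡⟨ cong ((-1ℤ ^ p) *_) (D-cong (2 ℕ.+ n) (Y 0 ◂ x ◂ Y′) (λ i → (x ◂ Y) (swap₀₁ i))
         λ { 0 c → refl ; 1 c → refl ; (suc (suc i)) c → refl }) ⟩
  (-1ℤ ^ p) * D (2 ℕ.+ n) (λ i → (x ◂ Y) (swap₀₁ i))
    ≡⟨ cong ((-1ℤ ^ p) *_) (D-swap n (x ◂ Y)) ⟩
  (-1ℤ ^ p) * - D (2 ℕ.+ n) (x ◂ Y)
    ≡⟨ move-neg (-1ℤ ^ p) (D (2 ℕ.+ n) (x ◂ Y)) ⟩
  (-1ℤ ^ suc p) * D (2 ℕ.+ n) (x ◂ Y) ∎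
  where
  Y′ : Mat
  Y′ i = Y (suc i)
  move-neg : ∀ s d → s * - d ≡ -1ℤ * s * d
  move-neg s d = trans (sym (ℤ.neg-distribʳ-* s d))
    (trans (sym (ℤ.-1*i≡-i (s * d))) (sym (ℤ.*-assoc -1ℤ s d)))

-- Isolates the last row of a reversal; the others form the reversal of the tail. Past `n` the
-- truncated `n ∸ i` stays 0 and the two sides part, hence the bound.
insert-last : ∀ {A : Set} n (f : ℕ → A) {i} → i ℕ.≤ n →
  f (n ∸ i) ≡ insert n (f 0) (λ i → f (suc (n ∸ suc i))) i
insert-last zero    f {zero}  _         = refl
insert-last (suc n) f {zero}  _         = refl
insert-last (suc n) f {suc i} (s≤s i≤n) = insert-last n f i≤n

*-square-one : ∀ {x y} → x * x ≡ 1ℤ → y * y ≡ 1ℤ → (x * y) * (x * y) ≡ 1ℤ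
*-square-one {x} {y} p q = trans (regroup x y) (cong₂ _*_ p q)
  where
  regroup : ∀ x y → (x * y) * (x * y) ≡ (x * x) * (y * y)
  regroup = solve-∀

^-square-one : ∀ n {x} → x * x ≡ 1ℤ → (x ^ n) * (x ^ n) ≡ 1ℤ
^-square-one zero    p = refl
^-square-one (suc n) {x} p = *-square-one {x} p (^-square-one n {x} p)

-- Equal to (-1)^(n(n - 1)/2). Only its square matters in the end, as rows and columns are both
-- reversed.
reversal-sign : ℕ → ℤ
reversal-sign zero    = 1ℤ
reversal-sign (suc n) = (-1ℤ ^ n) * reversal-sign n

reversal-sign-square : ∀ n → reversal-sign n * reversal-sign n ≡ 1ℤ
reversal-sign-square zero    = refl
reversal-sign-square (suc n) =
  *-square-one { -1ℤ ^ n } (^-square-one n { -1ℤ } refl) (reversal-sign-square n)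

D-reverse-rows : ∀ n (f : Mat) → D n (λ i → f (n ∸ suc i)) ≡ reversal-sign n * D n f
D-reverse-rows zero    f = refl
D-reverse-rows (suc n) f = begin
  D (suc n) (λ i → f (n ∸ i))
    ≡⟨ D-cong< (suc n) (λ i → f (n ∸ i)) (insert n (f 0) f′)
         (λ { (s≤s i≤n) j → cong (λ z → z j) (insert-last n f i≤n) }) ⟩
  D (suc n) (insert n (f 0) f′)
    ≡⟨ D-insert n ℕ.≤-refl (f 0) f′ ⟩
  (-1ℤ ^ n) * D (suc n) (f 0 ◂ f′)
    ≡⟨ cong ((-1ℤ ^ n) *_) (D-by-minors n (f 0 ◂ f′) f (reversal-sign n) (λ _ → refl)
         (λ j → D-reverse-rows n (λ r c → f (suc r) (skip j c)))) ⟩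
  (-1ℤ ^ n) * (reversal-sign n * D (suc n) f)
    ≡⟨ ℤ.*-assoc (-1ℤ ^ n) (reversal-sign n) (D (suc n) f) ⟨
  reversal-sign (suc n) * D (suc n) f ∎
  where
  f′ : Mat
  f′ i = f (suc (n ∸ suc i))

D-reverse : ∀ n (f : Mat) → D n (λ i j → f (n ∸ suc i) (n ∸ suc j)) ≡ D n f
D-reverse n f = begin
  D n (λ i j → f (n ∸ suc i) (n ∸ suc j))
    ≡⟨ D-reverse-rows n (λ i j → f i (n ∸ suc j)) ⟩
  ε * D n (λ i j → f i (n ∸ suc j))
    ≡⟨ cong (ε *_) (D-transpose n (λ i j → f i (n ∸ suc j))) ⟨
  ε * D n (λ j i → f i (n ∸ suc j))
    ≡⟨ cong (ε *_) (D-reverse-rows n (λ j i → f i j)) ⟩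
  ε * (ε * D n (λ j i → f i j))
    ≡⟨ ℤ.*-assoc ε ε (D n (λ j i → f i j)) ⟨
  ε * ε * D n (λ j i → f i j)
    ≡⟨ cong₂ _*_ (reversal-sign-square n) (D-transpose n f) ⟩
  1ℤ * D n f
    ≡⟨ ℤ.*-identityˡ (D n f) ⟩
  D n f ∎
  where ε = reversal-sign n

-- Block matrices and complementary minors

append : ∀ {A : Set} → ℕ → (ℕ → A) → (ℕ → A) → ℕ → A
append zero    a b = b
append (suc m) a b = a 0 ◂ append m (λ i → a (suc i)) b

append-map : ∀ {A B : Set} (h : A → B) m (a b : ℕ → A) i →
  h (append m a b i) ≡ append m (λ j → h (a j)) (λ j → h (b j)) i
append-map h zero    a b i       = refl
append-map h (suc m) a b zero    = refl
append-map h (suc m) a b (suc i) = append-map h m (λ j → a (suc j)) b i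

append-< : ∀ {A : Set} {m} (a b : ℕ → A) {i} → i < m → append m a b i ≡ a i
append-< {m = suc m} a b {zero}  _         = refl
append-< {m = suc m} a b {suc i} (s<s i<m) = append-< (λ j → a (suc j)) b i<m

append-insert : ∀ {A : Set} m (a b : ℕ → A) i →
  append m a b i ≡ insert m (b 0) (append m a (λ j → b (suc j))) i
append-insert zero    a b zero    = refl
append-insert zero    a b (suc i) = refl
append-insert (suc m) a b zero    = refl
append-insert (suc m) a b (suc i) = append-insert m (λ j → a (suc j)) b i

δ : Mat
δ zero    = 1ℤ ◂ λ _ → 0ℤ
δ (suc i) = 0ℤ ◂ δ i

δ-sym : ∀ i j → δ i j ≡ δ j i
δ-sym zero    zero    = refl
δ-sym zero    (suc j) = refl
δ-sym (suc i) zero    = refl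
δ-sym (suc i) (suc j) = δ-sym i j

only-first : ∀ n (g : Seq) → 1ℤ * g 0 - asum n (λ i → 0ℤ * g (suc i)) ≡ g 0
only-first n g = begin
  1ℤ * g 0 - asum n (λ i → 0ℤ * g (suc i))
    ≡⟨ cong₂ _-_ (ℤ.*-identityˡ (g 0)) (asum-zero n (λ i → ℤ.*-zeroˡ (g (suc i)))) ⟩
  g 0 - 0ℤ
    ≡⟨ ℤ.+-identityʳ (g 0) ⟩
  g 0 ∎

-- The first column is a unit vector, so only the corner minor survives, and it has the same shape
-- with `B` shifted by one row.
D-identity-left : ∀ m n (B : Mat) →
  D (m ℕ.+ n) (λ i → append m (δ i) (B i)) ≡ D n (λ i → B (m ℕ.+ i))
D-identity-left zero    n B = refl
D-identity-left (suc m) n B = begin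
  D (suc (m ℕ.+ n)) (λ i → append (suc m) (δ i) (B i))
    ≡⟨ column-expansion (m ℕ.+ n) (λ i → append (suc m) (δ i) (B i)) ⟩
  1ℤ * cofactor 0 - asum (m ℕ.+ n) (λ i → 0ℤ * cofactor (suc i))
    ≡⟨ only-first (m ℕ.+ n) cofactor ⟩
  cofactor 0
    ≡⟨ D-identity-left m n (λ i → B (suc i)) ⟩
  D n (λ i → B (suc m ℕ.+ i)) ∎
  where
  cofactor : Seq
  cofactor i = D (m ℕ.+ n) (λ r c → append (suc m) (δ (skip i r)) (B (skip i r)) (suc c))

-- The row `δ 0` lies under `m` rows: lifting it to the top costs (-1)^m, and expanding along it
-- removes column 0. This happens `n` times. The size is written `n + m` so that it unfolds along
-- with `n`.
D-identity-below : ∀ m n (A : Mat) →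
  D (n ℕ.+ m) (append m A δ) ≡ ((-1ℤ ^ m) ^ n) * D m (λ i j → A i (n ℕ.+ j))
D-identity-below m zero    A = trans
  (D-cong< m (append m A δ) A (λ i<m j → cong (λ z → z j) (append-< A δ i<m)))
  (sym (ℤ.*-identityˡ (D m A)))
D-identity-below m (suc n) A = begin
  D (suc (n ℕ.+ m)) (append m A δ)
    ≡⟨ D-cong (suc (n ℕ.+ m)) (append m A δ) (insert m (δ 0) Y)
         (λ i j → cong (λ z → z j) (append-insert m A δ i)) ⟩
  D (suc (n ℕ.+ m)) (insert m (δ 0) Y)
    ≡⟨ D-insert (n ℕ.+ m) (ℕ.m≤n+m m n) (δ 0) Y ⟩
  (-1ℤ ^ m) * D (suc (n ℕ.+ m)) (δ 0 ◂ Y)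
    ≡⟨ cong ((-1ℤ ^ m) *_) (only-first (n ℕ.+ m) (λ j → D (n ℕ.+ m) (λ r c → Y r (skip j c)))) ⟩
  (-1ℤ ^ m) * D (n ℕ.+ m) (λ r c → Y r (suc c))
    ≡⟨ cong ((-1ℤ ^ m) *_) (D-cong (n ℕ.+ m) (λ r c → Y r (suc c)) (append m (λ i j → A i (suc j)) δ)
         (λ i j → cong (λ z → z j) (append-map (λ z c → z (suc c)) m A (λ j → δ (suc j)) i))) ⟩
  (-1ℤ ^ m) * D (n ℕ.+ m) (append m (λ i j → A i (suc j)) δ)
    ≡⟨ cong ((-1ℤ ^ m) *_) (D-identity-below m n (λ i j → A i (suc j))) ⟩
  (-1ℤ ^ m) * (((-1ℤ ^ m) ^ n) * D m (λ i j → A i (suc n ℕ.+ j)))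
    ≡⟨ ℤ.*-assoc (-1ℤ ^ m) ((-1ℤ ^ m) ^ n) (D m (λ i j → A i (suc n ℕ.+ j))) ⟨
  ((-1ℤ ^ m) ^ suc n) * D m (λ i j → A i (suc n ℕ.+ j)) ∎
  where
  Y : Mat
  Y = append m A (λ j → δ (suc j))

⊡-append : ∀ m (L A B : Mat) i j →
  (L ⊡ λ s → append m (A s) (B s)) i j ≡ append m ((L ⊡ A) i) ((L ⊡ B) i) j
⊡-append zero    L A B i j       = refl
⊡-append (suc m) L A B i zero    = refl
⊡-append (suc m) L A B i (suc j) = ⊡-append m L (λ s c → A s (suc c)) B i j

append-cong : ∀ m {a a′ b b′ : Seq} → (∀ i → a i ≡ a′ i) → (∀ i → b i ≡ b′ i) →
  ∀ i → append m a b i ≡ append m a′ b′ i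
append-cong zero    p q i       = q i
append-cong (suc m) p q zero    = p 0
append-cong (suc m) p q (suc i) = append-cong m (λ j → p (suc j)) q i

-- Jacobi's complementary minor identity for M = L⁻¹: apply det to L [M | I] = [I | L].
complementary-minor : ∀ m n (L M : Mat) → (∀ i → L i i ≡ 1ℤ) →
  (∀ i j → (L ⊡ δ) i j ≡ L i j) → (∀ i j → (L ⊡ M) i j ≡ δ i j) →
  D n (λ i j → L (m ℕ.+ i) j) ≡ ((-1ℤ ^ m) ^ n) * D m (λ i j → M (n ℕ.+ j) i)
complementary-minor m n L M unit Lδ LM = begin
  D n (λ i → L (m ℕ.+ i))
    ≡⟨ D-identity-left m n L ⟨
  D (m ℕ.+ n) (λ i → append m (δ i) (L i))
    ≡⟨ D-cong (m ℕ.+ n) (L ⊡ M∣δ) (λ i → append m (δ i) (L i)) (λ i j → trans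
         (⊡-append m L M δ i j) (append-cong m (LM i) (Lδ i) j)) ⟨
  D (m ℕ.+ n) (L ⊡ M∣δ)
    ≡⟨ D-unitriangular (m ℕ.+ n) L M∣δ unit ⟩
  D (m ℕ.+ n) M∣δ
    -- Transposed, the identity block consists of whole rows, which `D-identity-below` removes one
    -- at a time.
    ≡⟨ D-transpose (m ℕ.+ n) M∣δ ⟨
  D (m ℕ.+ n) (λ j i → M∣δ i j)
    ≡⟨ D-cong (m ℕ.+ n) (λ j i → M∣δ i j) (append m (λ j i → M i j) δ) (λ j i → trans
         (append-cong m (λ _ → refl) (δ-sym i) j)
         (sym (append-map (λ z → z i) m (λ j i → M i j) δ j))) ⟩
  D (m ℕ.+ n) (append m (λ j i → M i j) δ)
    ≡⟨ cong (λ N → D N (append m (λ j i → M i j) δ)) (ℕ.+-comm m n) ⟩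
  D (n ℕ.+ m) (append m (λ j i → M i j) δ)
    ≡⟨ D-identity-below m n (λ j i → M i j) ⟩
  ((-1ℤ ^ m) ^ n) * D m (λ i j → M (n ℕ.+ j) i) ∎
  where
  M∣δ : Mat
  M∣δ i = append m (M i) (δ i)

-- Cancelling the signs

prod : ℕ → Seq → ℤ
prod zero    t = 1ℤ
prod (suc n) t = t 0 * prod n (λ i → t (suc i))

D-scale-rows : ∀ n (t : Seq) (f : Mat) → D n (λ i j → t i * f i j) ≡ prod n t * D n f
D-scale-rows zero    t f = refl
D-scale-rows (suc n) t f = begin
  asum (suc n) (λ j → t 0 * f 0 j * D n (λ r c → t (suc r) * f (suc r) (skip j c)))
    ≡⟨ asum-cong (suc n) (λ j → trans
         (cong (t 0 * f 0 j *_) (D-scale-rows n (λ i → t (suc i)) (λ r c → f (suc r) (skip j c))))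
         (regroup (t 0) (f 0 j) (prod n (λ i → t (suc i))) (D n (λ r c → f (suc r) (skip j c))))) ⟩
  asum (suc n) (λ j → prod (suc n) t * (f 0 j * D n (λ r c → f (suc r) (skip j c))))
    ≡⟨ asum-*ˡ (suc n) (prod (suc n) t) (λ j → f 0 j * D n (λ r c → f (suc r) (skip j c))) ⟩
  prod (suc n) t * D (suc n) f ∎
  where
  regroup : ∀ a x b y → a * x * (b * y) ≡ a * b * (x * y)
  regroup = solve-∀

prod-*ˡ : ∀ n a (t : Seq) → prod n (λ i → a * t i) ≡ (a ^ n) * prod n t
prod-*ˡ zero    a t = refl
prod-*ˡ (suc n) a t = trans (cong (a * t 0 *_) (prod-*ˡ n a _)) (regroup a (t 0) (a ^ n) _)
  where
  regroup : ∀ a x b y → a * x * (b * y) ≡ a * b * (x * y)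
  regroup = solve-∀

prod-square-one : ∀ n (t : Seq) → (∀ i → t i * t i ≡ 1ℤ) → prod n t * prod n t ≡ 1ℤ
prod-square-one zero    t e = refl
prod-square-one (suc n) t e = *-square-one {t 0} (e 0) (prod-square-one n _ (λ i → e (suc i)))

-1^-square : ∀ n → (-1ℤ ^ n) * (-1ℤ ^ n) ≡ 1ℤ
-1^-square n = ^-square-one n { -1ℤ } refl

-- The factor (-1)^n in each of the `m` rows yields (-1)^(mn), which cancels against the sign in
-- front. The row signs (-1)^i and the column signs (-1)^j have equal products, which cancel too.
D-checkerboard : ∀ m n (G : Mat) →
  ((-1ℤ ^ m) ^ n) * D m (λ i j → (-1ℤ ^ (n ℕ.+ j)) * (-1ℤ ^ i) * G i j) ≡ D m G
D-checkerboard m n G = begin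
  ((-1ℤ ^ m) ^ n) * D m (λ i j → (-1ℤ ^ (n ℕ.+ j)) * (-1ℤ ^ i) * G i j)
    ≡⟨ cong (((-1ℤ ^ m) ^ n) *_) (D-cong m (λ i j → (-1ℤ ^ (n ℕ.+ j)) * (-1ℤ ^ i) * G i j)
         (λ i j → (-1ℤ ^ n) * t i * (t j * G i j))
         (λ i j → trans (cong (λ z → z * t i * G i j) (ℤ.^-distribˡ-+-* -1ℤ n j))
           (regroup (-1ℤ ^ n) (t j) (t i) (G i j)))) ⟩
  ((-1ℤ ^ m) ^ n) * D m (λ i j → (-1ℤ ^ n) * t i * (t j * G i j))
    ≡⟨ cong₂ _*_ power-comm (D-scale-rows m (λ i → (-1ℤ ^ n) * t i) (λ i j → t j * G i j)) ⟩
  ((-1ℤ ^ n) ^ m) * (prod m (λ i → (-1ℤ ^ n) * t i) * D m (λ i j → t j * G i j))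
    ≡⟨ cong₂ (λ x y → ((-1ℤ ^ n) ^ m) * (x * y)) (prod-*ˡ m (-1ℤ ^ n) t) (begin
         D m (λ i j → t j * G i j)  ≡⟨ D-transpose m (λ i j → t j * G i j) ⟨
         D m (λ j i → t j * G i j)  ≡⟨ D-scale-rows m t (λ j i → G i j) ⟩
         prod m t * D m (λ j i → G i j)  ≡⟨ cong (prod m t *_) (D-transpose m G) ⟩
         prod m t * D m G ∎) ⟩
  ((-1ℤ ^ n) ^ m) * (((-1ℤ ^ n) ^ m) * prod m t * (prod m t * D m G))
    ≡⟨ regroup′ ((-1ℤ ^ n) ^ m) (prod m t) (D m G) ⟩
  (((-1ℤ ^ n) ^ m) * ((-1ℤ ^ n) ^ m)) * (prod m t * prod m t) * D m G
    ≡⟨ cong₂ (λ x y → x * y * D m G) (^-square-one m { -1ℤ ^ n } (-1^-square n))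
         (prod-square-one m t -1^-square) ⟩
  1ℤ * 1ℤ * D m G
    ≡⟨ ℤ.*-identityˡ (D m G) ⟩
  D m G ∎
  where
  t : Seq
  t i = -1ℤ ^ i
  regroup : ∀ a x y c → a * x * y * c ≡ a * y * (x * c)
  regroup = solve-∀
  regroup′ : ∀ e p d → e * (e * p * (p * d)) ≡ (e * e) * (p * p) * d
  regroup′ = solve-∀
  power-comm : (-1ℤ ^ m) ^ n ≡ (-1ℤ ^ n) ^ m
  power-comm = begin
    (-1ℤ ^ m) ^ n      ≡⟨ ℤ.^-*-assoc -1ℤ m n ⟩
    -1ℤ ^ (m ℕ.* n)    ≡⟨ cong (-1ℤ ^_) (ℕ.*-comm m n) ⟩
    -1ℤ ^ (n ℕ.* m)    ≡⟨ ℤ.^-*-assoc -1ℤ n m ⟨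
    (-1ℤ ^ n) ^ m      ∎

-- Lower triangular arrays

sum-zero : ∀ n {g : Seq} → (∀ s → g s ≡ 0ℤ) → sum n g ≡ 0ℤ
sum-zero zero    e = refl
sum-zero (suc n) e = cong₂ _+_ (e 0) (sum-zero n (λ s → e (suc s)))

sum-minus : ∀ n (g h : Seq) → sum n (λ s → g s - h s) ≡ sum n g - sum n h
sum-minus zero    g h = refl
sum-minus (suc n) g h = trans (cong (_+_ (g 0 - h 0)) (sum-minus n _ _)) (regroup (g 0) (h 0) _ _)
  where
  regroup : ∀ x y s t → x - y + (s - t) ≡ x + s - (y + t)
  regroup = solve-∀

-- The Toeplitz entry g(r - s), zero for r < s, by a recursion that avoids subtraction. Arrays whose
-- columns have different generators are written `tri (a s) r s`.
tri : Seq → Mat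
tri g r       zero    = g r
tri g zero    (suc s) = 0ℤ
tri g (suc r) (suc s) = tri g r s

tri-cong : ∀ {g h : Seq} → (∀ t → g t ≡ h t) → ∀ r s → tri g r s ≡ tri h r s
tri-cong e r       zero    = e r
tri-cong e zero    (suc s) = refl
tri-cong e (suc r) (suc s) = tri-cong e r s

tri-diagonal : ∀ (g : Seq) s → tri g s s ≡ g 0
tri-diagonal g zero    = refl
tri-diagonal g (suc s) = tri-diagonal g s

-- (-1)^(r - s) factors into a row sign and a column sign, a form that can be pulled out of a
-- determinant.
tri-sign : ∀ (g : Seq) r s →
  tri (λ t → (-1ℤ ^ t) * g t) r s ≡ (-1ℤ ^ r) * (-1ℤ ^ s) * tri g r s
tri-sign g r zero = cong (_* g r) (sym (ℤ.*-identityʳ (-1ℤ ^ r)))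
tri-sign g zero (suc s) = sym (ℤ.*-zeroʳ (1ℤ * (-1ℤ ^ suc s)))
tri-sign g (suc r) (suc s) = trans (tri-sign g r s) (two-signs (-1ℤ ^ r) (-1ℤ ^ s) (tri g r s))
  where
  two-signs : ∀ x y z → x * y * z ≡ -1ℤ * x * (-1ℤ * y) * z
  two-signs x y z = cong (_* z) (begin
    x * y                   ≡⟨ cancel x y ⟩
    - x * - y               ≡⟨ cong₂ _*_ (ℤ.-1*i≡-i x) (ℤ.-1*i≡-i y) ⟨
    -1ℤ * x * (-1ℤ * y)     ∎)
    where
    cancel : ∀ x y → x * y ≡ - x * - y
    cancel = solve-∀

δ-tri : ∀ i j → δ i j ≡ tri (1ℤ ◂ λ _ → 0ℤ) i j
δ-tri zero    zero    = refl
δ-tri (suc i) zero    = refl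
δ-tri zero    (suc j) = refl
δ-tri (suc i) (suc j) = δ-tri i j

-- Column `j` of the right factor starts at row `j`, so s = j + l turns the sum into a convolution
-- at r - j. Each recursive step strips one vanishing term and shifts `a`.
tri-⊡ : ∀ (a : ℕ → Seq) (b : Seq) r j →
  sum (suc r) (λ s → tri (a s) r s * tri b s j) ≡
  tri (λ t → sum (suc t) (λ l → tri (a (j ℕ.+ l)) t l * b l)) r j
tri-⊡ a b r       zero    = refl
tri-⊡ a b zero    (suc j) = trans (ℤ.+-identityʳ (a 0 0 * 0ℤ)) (ℤ.*-zeroʳ (a 0 0))
tri-⊡ a b (suc r) (suc j) = begin
  a 0 (suc r) * 0ℤ + sum (suc r) (λ s → tri (a (suc s)) r s * tri b s j)
    ≡⟨ cong₂ _+_ (ℤ.*-zeroʳ (a 0 (suc r))) (tri-⊡ (λ s → a (suc s)) b r j) ⟩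
  0ℤ + tri (λ t → sum (suc t) (λ l → tri (a (suc j ℕ.+ l)) t l * b l)) r j
    ≡⟨ ℤ.+-identityˡ _ ⟩
  tri (λ t → sum (suc t) (λ l → tri (a (suc j ℕ.+ l)) t l * b l)) r j ∎

-- `_⊡_` reads nothing above the diagonal, so this equation expresses that the array vanishes there,
-- the form of triangularity that `complementary-minor` takes.
tri-⊡-δ : ∀ (a : ℕ → Seq) r j → ((λ r s → tri (a s) r s) ⊡ δ) r j ≡ tri (a j) r j
tri-⊡-δ a r j = begin
  sum (suc r) (λ s → tri (a s) r s * δ s j)
    ≡⟨ sum-cong (suc r) (λ s → cong (tri (a s) r s *_) (δ-tri s j)) ⟩
  sum (suc r) (λ s → tri (a s) r s * tri e₀ s j)
    ≡⟨ tri-⊡ a e₀ r j ⟩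
  tri (λ t → sum (suc t) (λ l → tri (a (j ℕ.+ l)) t l * e₀ l)) r j
    ≡⟨ tri-cong (λ t → begin
         a (j ℕ.+ 0) t * 1ℤ + sum t (λ l → tri (a (j ℕ.+ suc l)) t (suc l) * 0ℤ)
           ≡⟨ cong₂ _+_ (ℤ.*-identityʳ (a (j ℕ.+ 0) t)) (sum-zero t (λ l → ℤ.*-zeroʳ (tri (a (j ℕ.+ suc l)) t (suc l)))) ⟩
         a (j ℕ.+ 0) t + 0ℤ
           ≡⟨ ℤ.+-identityʳ (a (j ℕ.+ 0) t) ⟩
         a (j ℕ.+ 0) t
           ≡⟨ cong (λ z → a z t) (ℕ.+-identityʳ j) ⟩
         a j t ∎) r j ⟩
  tri (a j) r j ∎
  where
  e₀ : Seq
  e₀ = 1ℤ ◂ λ _ → 0ℤ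

-- Powers of the Catalan series and the inverse array

-- Coefficient of z^l in c(z)^b. The last clause is c = 1 + z c^2 multiplied by c^b, so no division
-- occurs.
cat : ℕ → ℕ → ℕ
cat b       zero    = 1
cat zero    (suc l) = 0
cat (suc b) (suc l) = cat b (suc l) ℕ.+ cat (2 ℕ.+ b) l

-- Coefficient of z^t in (1 - z)^(-d).
multichoose : ℕ → ℕ → ℕ
multichoose zero    zero    = 1
multichoose zero    (suc t) = 0
multichoose (suc d) t       = (t ℕ.+ d) C t

-- Coefficientwise form of (1 - z)^(-d) + z (1 - z)^(-(d + 1)) = (1 - z)^(-(d + 1)).
multichoose-pascal : ∀ d t →
  multichoose d (suc t) ℕ.+ multichoose (suc d) t ≡ multichoose (suc d) (suc t)
multichoose-pascal zero t rewrite ℕ.+-identityʳ t = trans (nCn≡1 t) (sym (nCn≡1 (suc t)))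
multichoose-pascal (suc d) t rewrite ℕ.+-suc t d =
  trans (ℕ.+-comm (suc (t ℕ.+ d) C suc t) _) (nCk+nC[k+1]≡[n+1]C[k+1] (suc (t ℕ.+ d)) t)

geo : ℕ → Seq
geo d t = + multichoose d t

-- Coefficient of z^t in (1 - z)^(-(a + 1)) c(-z / (1 - z)^2)^b, which is
-- (1 - z)^(b - a - 1) because c(-z / (1 - z)^2) = 1 - z.
S : ℕ → ℕ → Seq
S a b t = sum (suc t) (λ l → tri (geo (suc (2 ℕ.* l ℕ.+ a))) t l * ((-1ℤ ^ l) * + cat b l))

-- c^(b + 1) = c^b + z c^(b + 2)
S-step : ∀ a b t → S a (suc b) (suc t) ≡ S a b (suc t) - S (2 ℕ.+ a) (2 ℕ.+ b) t
S-step a b t = begin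
  head + sum (suc t) (λ l → x l * (-1ℤ * s l * (+ cat b (suc l) + + cat (2 ℕ.+ b) l)))
    ≡⟨ cong (_+_ head) (sum-cong (suc t) (λ l → split (x l) (s l) (+ cat b (suc l)) (+ cat (2 ℕ.+ b) l))) ⟩
  head + sum (suc t) (λ l → x l * (-1ℤ * s l * + cat b (suc l)) - x l * (s l * + cat (2 ℕ.+ b) l))
    ≡⟨ cong (_+_ head) (sum-minus (suc t) (λ l → x l * (-1ℤ * s l * + cat b (suc l))) (λ l → x l * (s l * + cat (2 ℕ.+ b) l))) ⟩
  head + (tail - sum (suc t) (λ l → x l * (s l * + cat (2 ℕ.+ b) l)))
    ≡⟨ ℤ.+-assoc head tail (- sum (suc t) (λ l → x l * (s l * + cat (2 ℕ.+ b) l))) ⟨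
  S a b (suc t) - sum (suc t) (λ l → x l * (s l * + cat (2 ℕ.+ b) l))
    ≡⟨ cong (λ z → S a b (suc t) - z) (sum-cong (suc t) λ l → cong (_* (s l * + cat (2 ℕ.+ b) l))
         (tri-cong (λ u → cong (λ d → geo (suc d) u) (shift l a)) t l)) ⟩
  S a b (suc t) - S (2 ℕ.+ a) (2 ℕ.+ b) t ∎
  where
  x s : Seq
  x l = tri (geo (suc (2 ℕ.* suc l ℕ.+ a))) t l
  s l = -1ℤ ^ l
  head tail : ℤ
  head = geo (suc a) (suc t) * (1ℤ * 1ℤ)
  tail = sum (suc t) (λ l → x l * (-1ℤ * s l * + cat b (suc l)))
  split : ∀ x s p q → x * (-1ℤ * s * (p + q)) ≡ x * (-1ℤ * s * p) - x * (s * q)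
  split x s p q = trans (cong (λ z → x * (z * (p + q))) (ℤ.-1*i≡-i s))
    (trans (go x s p q) (cong (λ z → x * (z * p) - x * (s * q)) (sym (ℤ.-1*i≡-i s))))
    where
    go : ∀ x s p q → x * (- s * (p + q)) ≡ x * (- s * p) - x * (s * q)
    go = solve-∀
  shift : ∀ l a → 2 ℕ.* suc l ℕ.+ a ≡ 2 ℕ.* l ℕ.+ (2 ℕ.+ a)
  shift = ℕRing.solve-∀

-- The hypothesis fixes d = a + 1 - b. Both terms of `S-step` have d + 1 in place of d, so they
-- combine to (1 - z)(1 - z)^(-(d + 1)) = (1 - z)^(-d). One call lowers `b`; the other raises `b`
-- but lowers `t`, so the recursion ends.
S-geo : ∀ t a b d → suc a ≡ b ℕ.+ d → S a b t ≡ geo d t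
S-geo zero a b d e = geo-zero d
  where
  geo-zero : ∀ d → 1ℤ ≡ geo d 0
  geo-zero zero    = refl
  geo-zero (suc d) = refl
S-geo (suc t) a zero d refl = begin
  geo (suc a) (suc t) * 1ℤ + sum (suc t) (λ l → x l * ((-1ℤ ^ suc l) * 0ℤ))
    ≡⟨ cong₂ _+_ (ℤ.*-identityʳ (geo (suc a) (suc t))) (sum-zero (suc t) (λ l →
         trans (cong (x l *_) (ℤ.*-zeroʳ (-1ℤ ^ suc l))) (ℤ.*-zeroʳ (x l)))) ⟩
  geo (suc a) (suc t) + 0ℤ
    ≡⟨ ℤ.+-identityʳ (geo (suc a) (suc t)) ⟩
  geo (suc a) (suc t) ∎
  where
  x : Seq
  x l = tri (geo (suc (2 ℕ.* suc l ℕ.+ a))) t l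
S-geo (suc t) a (suc b) d e = begin
  S a (suc b) (suc t)
    ≡⟨ S-step a b t ⟩
  S a b (suc t) - S (2 ℕ.+ a) (2 ℕ.+ b) t
    ≡⟨ cong₂ _-_ (S-geo (suc t) a b (suc d) e′)
         (S-geo t (2 ℕ.+ a) (2 ℕ.+ b) (suc d) (cong (2 ℕ.+_) e′)) ⟩
  geo (suc d) (suc t) - geo (suc d) t
    ≡⟨ cong (λ z → + z - geo (suc d) t) (multichoose-pascal d t) ⟨
  geo d (suc t) + geo (suc d) t - geo (suc d) t
    ≡⟨ cancel (geo d (suc t)) (geo (suc d) t) ⟩
  geo d (suc t) ∎
  where
  e′ : suc a ≡ b ℕ.+ suc d
  e′ = trans e (sym (ℕ.+-suc b d))
  cancel : ∀ x y → x + y - y ≡ x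
  cancel = solve-∀

binomials catalans : ℕ → ℕ → Seq
binomials k s = geo (suc (2 ℕ.* s ℕ.+ k))
catalans  k s l = + cat (suc (2 ℕ.* s ℕ.+ k)) l

L M : ℕ → Mat
L k r s = tri (binomials k s) r s
M k r s = tri (λ l → (-1ℤ ^ l) * catalans k s l) r s

L⊡M : ∀ k i j → (L k ⊡ M k) i j ≡ δ i j
L⊡M k i j = begin
  (L k ⊡ M k) i j
    ≡⟨ tri-⊡ (binomials k) (λ l → (-1ℤ ^ l) * catalans k j l) i j ⟩
  tri (λ t → sum (suc t) (λ l → tri (binomials k (j ℕ.+ l)) t l * ((-1ℤ ^ l) * catalans k j l))) i j
    ≡⟨ tri-cong (λ t → trans
         (sum-cong (suc t) (λ l → cong (_* ((-1ℤ ^ l) * catalans k j l))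
           (tri-cong (λ u → cong (λ d → geo (suc d) u) (regroup j l k)) t l)))
         -- Here b = a + 1, so the exponent d is 0 and the series is 1.
         (trans (S-geo t (2 ℕ.* j ℕ.+ k) (suc (2 ℕ.* j ℕ.+ k)) 0 (sym (ℕ.+-identityʳ _))) (geo-0 t))) i j ⟩
  tri (1ℤ ◂ λ _ → 0ℤ) i j
    ≡⟨ δ-tri i j ⟨
  δ i j ∎
  where
  regroup : ∀ j l k → 2 ℕ.* (j ℕ.+ l) ℕ.+ k ≡ 2 ℕ.* l ℕ.+ (2 ℕ.* j ℕ.+ k)
  regroup = ℕRing.solve-∀
  geo-0 : ∀ t → geo 0 t ≡ (1ℤ ◂ λ _ → 0ℤ) t
  geo-0 zero    = refl
  geo-0 (suc t) = refl

D-binomials≡D-catalans : ∀ n m k →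
  D n (λ i j → L k (m ℕ.+ i) j) ≡ D m (λ i j → tri (catalans k i) (n ℕ.+ j) i)
D-binomials≡D-catalans n m k = begin
  D n (λ i j → L k (m ℕ.+ i) j)
    ≡⟨ complementary-minor m n (L k) (M k) (λ s → tri-diagonal (binomials k s) s) (tri-⊡-δ (binomials k)) (L⊡M k) ⟩
  ((-1ℤ ^ m) ^ n) * D m (λ i j → M k (n ℕ.+ j) i)
    ≡⟨ cong (((-1ℤ ^ m) ^ n) *_) (D-cong m (λ i j → M k (n ℕ.+ j) i)
         (λ i j → (-1ℤ ^ (n ℕ.+ j)) * (-1ℤ ^ i) * tri (catalans k i) (n ℕ.+ j) i)
         (λ i j → tri-sign (catalans k i) (n ℕ.+ j) i)) ⟩
  ((-1ℤ ^ m) ^ n) * D m (λ i j → (-1ℤ ^ (n ℕ.+ j)) * (-1ℤ ^ i) * tri (catalans k i) (n ℕ.+ j) i)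
    ≡⟨ D-checkerboard m n (λ i j → tri (catalans k i) (n ℕ.+ j) i) ⟩
  D m (λ i j → tri (catalans k i) (n ℕ.+ j) i) ∎

-- Closed form of the ballot numbers

absorption : ∀ n k → suc k ℕ.* (suc n C suc k) ≡ suc n ℕ.* (n C k)
absorption n zero = trans (ℕ.+-identityʳ _) (trans (nC1≡n (suc n)) (sym (ℕ.*-identityʳ (suc n))))
absorption zero (suc k) = trans
  (cong (suc (suc k) ℕ.*_) (k>n⇒nCk≡0 {1} {suc (suc k)} (s<s z<s)))
  (trans (ℕ.*-zeroʳ (suc (suc k))) (sym (trans (ℕ.+-identityʳ (0 C suc k)) (k>n⇒nCk≡0 {0} {suc k} z<s))))
absorption (suc n) (suc k) = begin
  suc (suc k) ℕ.* (suc (suc n) C suc (suc k))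
    ≡⟨ cong (suc (suc k) ℕ.*_) (nCk+nC[k+1]≡[n+1]C[k+1] (suc n) (suc k)) ⟨
  suc (suc k) ℕ.* (p ℕ.+ (suc n C suc (suc k)))
    ≡⟨ split (suc k) p (suc n C suc (suc k)) ⟩
  suc k ℕ.* p ℕ.+ p ℕ.+ suc (suc k) ℕ.* (suc n C suc (suc k))
    ≡⟨ cong₂ (λ x y → x ℕ.+ p ℕ.+ y) (absorption n k) (absorption n (suc k)) ⟩
  suc n ℕ.* (n C k) ℕ.+ p ℕ.+ suc n ℕ.* (n C suc k)
    ≡⟨ collect (suc n) (n C k) p (n C suc k) ⟩
  suc n ℕ.* (n C k ℕ.+ n C suc k) ℕ.+ p
    ≡⟨ cong (λ x → suc n ℕ.* x ℕ.+ p) (nCk+nC[k+1]≡[n+1]C[k+1] n k) ⟩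
  suc n ℕ.* p ℕ.+ p
    ≡⟨ ℕ.+-comm _ p ⟩
  suc (suc n) ℕ.* p ∎
  where
  p = suc n C suc k
  split : ∀ k p q → suc k ℕ.* (p ℕ.+ q) ≡ k ℕ.* p ℕ.+ p ℕ.+ suc k ℕ.* q
  split = ℕRing.solve-∀
  collect : ∀ n x p y → n ℕ.* x ℕ.+ p ℕ.+ n ℕ.* y ≡ n ℕ.* (x ℕ.+ y) ℕ.+ p
  collect = ℕRing.solve-∀

-- Stated without division. Both recursive terms of `cat` belong to the same top index `q` = 2(l +
-- 1) + b = 2l + (2 + b), so multiplying by `q` admits both induction hypotheses; `q` is positive
-- and cancels.
cat-formula : ∀ l b → (2 ℕ.* l ℕ.+ b) ℕ.* cat b l ≡ b ℕ.* ((2 ℕ.* l ℕ.+ b) C l)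
cat-formula zero    b       = refl
cat-formula (suc l) zero    = ℕ.*-zeroʳ (2 ℕ.* suc l ℕ.+ 0)
cat-formula (suc l) (suc b) = subst
  (λ N → N ℕ.* (x ℕ.+ y) ≡ suc b ℕ.* (N C suc l)) (sym (ℕ.+-suc (2 ℕ.* suc l) b))
  (ℕ.*-cancelˡ-≡ (suc q ℕ.* (x ℕ.+ y)) (suc b ℕ.* (suc q C suc l)) q (begin
    q ℕ.* (suc q ℕ.* (x ℕ.+ y))
      ≡⟨ distrib q x y ⟩
    suc q ℕ.* (q ℕ.* x ℕ.+ q ℕ.* y)
      ≡⟨ cong₂ (λ u v → suc q ℕ.* (u ℕ.+ v)) (cat-formula (suc l) b)
           (subst (λ r → r ℕ.* y ≡ (2 ℕ.+ b) ℕ.* (r C l)) (shift l b) (cat-formula l (2 ℕ.+ b))) ⟩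
    suc q ℕ.* (b ℕ.* (q C suc l) ℕ.+ (2 ℕ.+ b) ℕ.* (q C l))
      ≡⟨ collect q b (q C suc l) (q C l) ⟩
    b ℕ.* (suc q ℕ.* (q C l ℕ.+ q C suc l)) ℕ.+ 2 ℕ.* (suc q ℕ.* (q C l))
      ≡⟨ cong₂ (λ u v → b ℕ.* (suc q ℕ.* u) ℕ.+ 2 ℕ.* v)
           (nCk+nC[k+1]≡[n+1]C[k+1] q l) (sym (absorption q l)) ⟩
    b ℕ.* (suc q ℕ.* (suc q C suc l)) ℕ.+ 2 ℕ.* (suc l ℕ.* (suc q C suc l))
      -- Since 2(l + 1) = q - b, the coefficient b(q + 1) + 2(l + 1) equals q(b + 1).
      ≡⟨ finish l b (suc q C suc l) ⟩
    q ℕ.* (suc b ℕ.* (suc q C suc l)) ∎))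
  where
  q x y : ℕ
  q = 2 ℕ.* suc l ℕ.+ b
  x = cat b (suc l)
  y = cat (2 ℕ.+ b) l
  distrib : ∀ q x y → q ℕ.* (suc q ℕ.* (x ℕ.+ y)) ≡ suc q ℕ.* (q ℕ.* x ℕ.+ q ℕ.* y)
  distrib = ℕRing.solve-∀
  shift : ∀ l b → 2 ℕ.* l ℕ.+ (2 ℕ.+ b) ≡ 2 ℕ.* suc l ℕ.+ b
  shift = ℕRing.solve-∀
  collect : ∀ q b u v → suc q ℕ.* (b ℕ.* u ℕ.+ (2 ℕ.+ b) ℕ.* v) ≡
    b ℕ.* (suc q ℕ.* (v ℕ.+ u)) ℕ.+ 2 ℕ.* (suc q ℕ.* v)
  collect = ℕRing.solve-∀
  finish : ∀ l b B → b ℕ.* (suc (2 ℕ.* suc l ℕ.+ b) ℕ.* B) ℕ.+ 2 ℕ.* (suc l ℕ.* B) ≡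
    (2 ℕ.* suc l ℕ.+ b) ℕ.* (suc b ℕ.* B)
  finish = ℕRing.solve-∀

ballot-cat : ∀ r l → ballot r (+ l) ≡ + cat (suc r) l
ballot-cat r l = cong +_ (begin
  (suc r ℕ.* (N C l)) / N
    ≡⟨ cong (_/ N) (subst (λ N → N ℕ.* cat (suc r) l ≡ suc r ℕ.* (N C l)) (ℕ.+-suc (2 ℕ.* l) r)
         (cat-formula l (suc r))) ⟨
  (N ℕ.* cat (suc r) l) / N
    ≡⟨ cong (_/ N) (ℕ.*-comm N (cat (suc r) l)) ⟩
  (cat (suc r) l ℕ.* N) / N
    ≡⟨ m*n/n≡m (cat (suc r) l) N ⟩
  cat (suc r) l ∎)
  where
  N : ℕ
  N = suc (2 ℕ.* l ℕ.+ r)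

-- From `det` to `D`

altSum-cong : ∀ {n} {f g : Fin n → ℤ} → (∀ j → f j ≡ g j) → altSum f ≡ altSum g
altSum-cong {zero}  e = refl
altSum-cong {suc n} e = cong₂ _-_ (e Fin.zero) (altSum-cong (λ j → e (Fin.suc j)))

det-cong : ∀ {n} {F G : Matrix n} → (∀ i j → F i j ≡ G i j) → det F ≡ det G
det-cong {zero}  e = refl
det-cong {suc n} e = altSum-cong λ j →
  cong₂ _*_ (e Fin.zero j) (det-cong (λ r c → e (Fin.suc r) (punchIn j c)))

altSum≡asum : ∀ n (g : Seq) → altSum {n} (λ j → g (toℕ j)) ≡ asum n g
altSum≡asum zero    g = refl
altSum≡asum (suc n) g = cong (_-_ (g 0)) (altSum≡asum n (λ j → g (suc j)))

toℕ-punchIn : ∀ {n} (j : Fin (suc n)) c → toℕ (punchIn j c) ≡ skip (toℕ j) (toℕ c)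
toℕ-punchIn Fin.zero    c           = refl
toℕ-punchIn (Fin.suc j) Fin.zero    = refl
toℕ-punchIn (Fin.suc j) (Fin.suc c) = cong suc (toℕ-punchIn j c)

det≡D : ∀ n (f : Mat) → det {n} (λ i j → f (toℕ i) (toℕ j)) ≡ D n f
det≡D zero    f = refl
det≡D (suc n) f = trans
  (altSum-cong {suc n} λ j → cong (f 0 (toℕ j) *_) (trans
    (det-cong {n} (λ r c → cong (f (suc (toℕ r))) (toℕ-punchIn j c)))
    (det≡D n (λ r c → f (suc r) (skip (toℕ j) c)))))
  (altSum≡asum (suc n) (λ j → f 0 j * D n (λ r c → f (suc r) (skip j c))))

-- Matching the integer-indexed entries

-- The shape of r - s as an integer: `nonneg s t` stands for `+ t` and `neg r u` for `-[1+ u ]`, the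
-- cases on which `binomℤ` and `ballot` split.
data Difference : ℕ → ℕ → Set where
  nonneg : ∀ s t → Difference (s ℕ.+ t) s
  neg    : ∀ r u → Difference r (suc (r ℕ.+ u))

difference : ∀ r s → Difference r s
difference r       zero    = nonneg 0 r
difference zero    (suc s) = neg 0 s
difference (suc r) (suc s) with difference r s
... | nonneg s t = nonneg (suc s) t
... | neg r u    = neg (suc r) u

tri-nonneg : ∀ (g : Seq) s t → tri g (s ℕ.+ t) s ≡ g t
tri-nonneg g zero    t = refl
tri-nonneg g (suc s) t = tri-nonneg g s t

tri-neg : ∀ (g : Seq) r u → tri g r (suc (r ℕ.+ u)) ≡ 0ℤ
tri-neg g zero    u = refl
tri-neg g (suc r) u = tri-neg g r u

[s+t]-s≡t : ∀ s t → + (s ℕ.+ t) - + s ≡ + t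
[s+t]-s≡t s t = cancel (+ s) (+ t)
  where
  cancel : ∀ x y → x + y - x ≡ y
  cancel = solve-∀

r-[1+r+u]≡-[1+u] : ∀ r u → + r - + suc (r ℕ.+ u) ≡ -[1+ u ]
r-[1+r+u]≡-[1+u] r u = trans (cong (λ z → + r - + z) (sym (ℕ.+-suc r u))) (cancel (+ r) (+ suc u))
  where
  cancel : ∀ x y → x - (x + y) ≡ - y
  cancel = solve-∀

binomℤ≡L : ∀ k r s → binomℤ (+ (r ℕ.+ s ℕ.+ k)) (+ r - + s) ≡ L k r s
binomℤ≡L k r s with difference r s
... | nonneg s t = begin
  binomℤ (+ (s ℕ.+ t ℕ.+ s ℕ.+ k)) (+ (s ℕ.+ t) - + s)
    ≡⟨ cong₂ (λ a b → binomℤ (+ a) b) (regroup s t k) ([s+t]-s≡t s t) ⟩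
  + ((t ℕ.+ (2 ℕ.* s ℕ.+ k)) C t)
    ≡⟨ tri-nonneg (binomials k s) s t ⟨
  L k (s ℕ.+ t) s ∎
  where
  regroup : ∀ s t k → s ℕ.+ t ℕ.+ s ℕ.+ k ≡ t ℕ.+ (2 ℕ.* s ℕ.+ k)
  regroup = ℕRing.solve-∀
... | neg r u = trans
  (cong (binomℤ (+ (r ℕ.+ suc (r ℕ.+ u) ℕ.+ k))) (r-[1+r+u]≡-[1+u] r u))
  (sym (tri-neg (binomials k (suc (r ℕ.+ u))) r u))

ballot≡tri : ∀ r n i → ballot r (+ n - + i) ≡ tri (λ l → + cat (suc r) l) n i
ballot≡tri r n i with difference n i
... | nonneg i t = trans (cong (ballot r) ([s+t]-s≡t i t))
  (trans (ballot-cat r t) (sym (tri-nonneg (λ l → + cat (suc r) l) i t)))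
... | neg n u = trans (cong (ballot r) (r-[1+r+u]≡-[1+u] n u))
  (sym (tri-neg (λ l → + cat (suc r) l) n u))

theorem6 : (n m k : ℕ) →
    (det {n} (λ i j → binomℤ (+ toℕ i + + toℕ j + + k + + m) (+ toℕ i - + toℕ j + + m))
    ≡ det {n} (λ i j → binomℤ (+ (2 Data.Nat.* n) + + m + + k - + suc (toℕ i) - + suc (toℕ j)) (+ suc (toℕ j) - + suc (toℕ i) + + m)))
    × (det {n} (λ i j → binomℤ (+ (2 Data.Nat.* n) + + m + + k - + suc (toℕ i) - + suc (toℕ j)) (+ suc (toℕ j) - + suc (toℕ i) + + m))
    ≡ det {m} (λ i j → ballot (2 Data.Nat.* toℕ i Data.Nat.+ k) (+ n - + toℕ i + + toℕ j)))
theorem6 n m k = trans first (sym second) , trans second (trans (D-binomials≡D-catalans n m k) (sym third))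
  where
  first-det second-det third-det : ℤ
  first-det  = det {n} (λ i j → binomℤ (+ toℕ i + + toℕ j + + k + + m) (+ toℕ i - + toℕ j + + m))
  second-det = det {n} (λ i j → binomℤ (+ (2 ℕ.* n) + + m + + k - + suc (toℕ i) - + suc (toℕ j)) (+ suc (toℕ j) - + suc (toℕ i) + + m))
  third-det  = det {m} (λ i j → ballot (2 ℕ.* toℕ i ℕ.+ k) (+ n - + toℕ i + + toℕ j))

  L↓ : Mat
  L↓ i j = L k (m ℕ.+ i) j

  shift-last : ∀ x y z → x - y + z ≡ z + x - y
  shift-last = solve-∀

  first : first-det ≡ D n L↓
  first = trans (det-cong {n} λ i j → trans
      (cong₂ binomℤ (cong +_ (regroup (toℕ i) (toℕ j) k m)) (shift-last (+ toℕ i) (+ toℕ j) (+ m)))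
      (binomℤ≡L k (m ℕ.+ toℕ i) (toℕ j)))
    (det≡D n L↓)
    where
    regroup : ∀ i j k m → i ℕ.+ j ℕ.+ k ℕ.+ m ≡ m ℕ.+ i ℕ.+ j ℕ.+ k
    regroup = ℕRing.solve-∀

  second : second-det ≡ D n L↓
  second = begin
    second-det
      ≡⟨ det-cong {n} (λ i j → trans
           (cong₂ binomℤ (top (toℕ i) (toℕ j) (Fin.toℕ<n i) (Fin.toℕ<n j))
             (bottom (toℕ i) (toℕ j) (Fin.toℕ<n i) (Fin.toℕ<n j)))
           (binomℤ≡L k (m ℕ.+ (n ∸ suc (toℕ i))) (n ∸ suc (toℕ j)))) ⟩
    det {n} (λ i j → L↓ (n ∸ suc (toℕ i)) (n ∸ suc (toℕ j)))
      ≡⟨ det≡D n (λ i j → L↓ (n ∸ suc i) (n ∸ suc j)) ⟩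
    D n (λ i j → L↓ (n ∸ suc i) (n ∸ suc j))
      ≡⟨ D-reverse n L↓ ⟩
    D n L↓ ∎
    where
    complement : ∀ {i} → i < n → + n ≡ + suc i + + (n ∸ suc i)
    complement i<n = cong +_ (sym (ℕ.m+[n∸m]≡n i<n))
    top : ∀ i j → i < n → j < n → + (2 ℕ.* n) + + m + + k - + suc i - + suc j ≡
      + (m ℕ.+ (n ∸ suc i) ℕ.+ (n ∸ suc j) ℕ.+ k)
    top i j i<n j<n = trans
      -- `2 * n` unfolds to n + (n + 0), whence the `0ℤ`; one copy of n is split at `i`, the other
      -- at `j`.
      (cong₂ (λ x y → x + (y + 0ℤ) + + m + + k - + suc i - + suc j) (complement i<n) (complement j<n))
      (cancel (+ suc i) (+ suc j) (+ (n ∸ suc i)) (+ (n ∸ suc j)) (+ m) (+ k))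
      where
      cancel : ∀ x y a b m k → x + a + (y + b + 0ℤ) + m + k - x - y ≡ m + a + b + k
      cancel = solve-∀
    bottom : ∀ i j → i < n → j < n → + suc j - + suc i + + m ≡ + (m ℕ.+ (n ∸ suc i)) - + (n ∸ suc j)
    bottom i j i<n j<n = begin
      + suc j - + suc i + + m
        -- Adding and subtracting n - 1 - j produces a copy of n split at `j`, which is then split
        -- at `i` instead.
        ≡⟨ widen (+ suc i) (+ suc j) (+ (n ∸ suc j)) (+ m) ⟩
      + suc j + + (n ∸ suc j) - + suc i - + (n ∸ suc j) + + m
        ≡⟨ cong (λ z → z - + suc i - + (n ∸ suc j) + + m) (trans (sym (complement j<n)) (complement i<n)) ⟩
      + suc i + + (n ∸ suc i) - + suc i - + (n ∸ suc j) + + m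
        ≡⟨ cancel (+ suc i) (+ (n ∸ suc i)) (+ (n ∸ suc j)) (+ m) ⟩
      + (m ℕ.+ (n ∸ suc i)) - + (n ∸ suc j) ∎
      where
      widen : ∀ x y b m → y - x + m ≡ y + b - x - b + m
      widen = solve-∀
      cancel : ∀ x a b m → x + a - x - b + m ≡ m + a - b
      cancel = solve-∀

  third : third-det ≡ D m (λ i j → tri (catalans k i) (n ℕ.+ j) i)
  third = trans (det-cong {m} λ i j → trans
      (cong (ballot (2 ℕ.* toℕ i ℕ.+ k)) (shift-middle (+ n) (+ toℕ i) (+ toℕ j)))
      (ballot≡tri (2 ℕ.* toℕ i ℕ.+ k) (n ℕ.+ toℕ j) (toℕ i)))
    (det≡D m (λ i j → tri (catalans k i) (n ℕ.+ j) i))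
    where
    shift-middle : ∀ x y z → x - y + z ≡ x + z - y
    shift-middle = solve-∀
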